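{- Let $p,q,r\in\mathbb{R}$. The polynomial $x^3+px^2+qx+r$ is a Ramanujan cubic polynomial if and only if it has the form $$\rho(h,s,x)=x^3+hsx^2-(h+3)s^2x+s^3$$ for some $h,s\in\mathbb{R}$ with $s\neq 0$.
   Context: A Ramanujan cubic polynomial (RCP) is a cubic polynomial $x^3+px^2+qx+r$ with $p,q,r\in\mathbb{R}$, $r\neq 0$, all of whose zeros are real and whose coefficients satisfy $p\,r^{1/3}+3\,r^{2/3}+q=0$. Here $r^{1/3}$ denotes the real cube root and $r^{2/3}=(r^{1/3})^2$. -}

module Defs where

open import Data.Integer.Base using (+_; -[1+_]; +[1+_]; +≤+)
import Data.Integer.Properties as ℤₚ
open import Data.Nat.Base as ℕ using (ℕ; zero; suc)
import Data.Nat.Properties as ℕₚ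
open import Data.Product using (∃-syntax; _×_; _,_)
open import Data.Rational using (ℚ; mkℚ; 0ℚ; 1ℚ; ½; 1/_; _/_; ∣_∣; _≤_; _<_; _≤?_;
  toℚᵘ; positive; nonNegative)
import Data.Rational as ℚ
open import Data.Rational.Properties
import Data.Rational.Unnormalised as ℚᵘ
import Data.Rational.Unnormalised.Properties as ℚᵘₚ
open import Data.Rational.Solver
open import Data.Sum using (inj₁; inj₂)
open import Function using (_$_)
open import Relation.Binary.PropositionalEquality
  using (_≡_; refl; sym; trans; cong; cong₂; subst; subst₂)
open import Relation.Nullary using (yes; no; contradiction)

open ≤-Reasoning
open +-*-Solver using (solve; _:=_; _:+_; _:*_; _:-_; :-_; con)

module ℚ-Lemmas where
  ∣-∣-flip : ∀ a b → ∣ a ℚ.- b ∣ ≡ ∣ b ℚ.- a ∣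
  ∣-∣-flip a b = trans (sym (∣-p∣≡∣p∣ (a ℚ.- b)))
    (cong ∣_∣ (solve 2 (λ a b → :- (a :- b) := b :- a) refl a b))

  p≤∣p∣ : ∀ p → p ≤ ∣ p ∣
  p≤∣p∣ p with ≤-total 0ℚ p
  ... | inj₁ 0≤p = ≤-reflexive (sym (0≤p⇒∣p∣≡p 0≤p))
  ... | inj₂ p≤0 = ≤-trans p≤0 (0≤∣p∣ p)

  -∣p∣≤p : ∀ p → ℚ.- ∣ p ∣ ≤ p
  -∣p∣≤p p = subst (ℚ.- ∣ p ∣ ≤_) (solve 1 (λ p → :- (:- p) := p) refl p)
    (neg-antimono-≤ (subst (ℚ.- p ≤_) (∣-p∣≡∣p∣ p) (p≤∣p∣ (ℚ.- p))))

  ∣p∣<-intro : ∀ {p ε} → p < ε → ℚ.- p < ε → ∣ p ∣ < ε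
  ∣p∣<-intro {p} {ε} p<ε -p<ε with ∣p∣≡p∨∣p∣≡-p p
  ... | inj₁ eq = subst (_< ε) (sym eq) p<ε
  ... | inj₂ eq = subst (_< ε) (sym eq) -p<ε

  p<ε⇐∣p∣<ε : ∀ {p ε} → ∣ p ∣ < ε → p < ε
  p<ε⇐∣p∣<ε {p} = ≤-<-trans (p≤∣p∣ p)

  0≤*0≤ : ∀ {p q} → 0ℚ ≤ p → 0ℚ ≤ q → 0ℚ ≤ p ℚ.* q
  0≤*0≤ {p} {q} 0≤p 0≤q = nonNegative⁻¹ (p ℚ.* q)
    {{nonNeg*nonNeg⇒nonNeg p {{nonNegative 0≤p}} q {{nonNegative 0≤q}}}}

  0<*0< : ∀ {p q} → 0ℚ < p → 0ℚ < q → 0ℚ < p ℚ.* q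
  0<*0< {p} {q} 0<p 0<q = positive⁻¹ (p ℚ.* q)
    {{pos*pos⇒pos p {{positive 0<p}} q {{positive 0<q}}}}

  0<+0≤ : ∀ {p q} → 0ℚ < p → 0ℚ ≤ q → 0ℚ < p ℚ.+ q
  0<+0≤ {p} {q} 0<p 0≤q = +-mono-<-≤ 0<p 0≤q

  *-mono-≤ : ∀ {a b c d} → 0ℚ ≤ a → 0ℚ ≤ d → a ≤ b → c ≤ d → a ℚ.* c ≤ b ℚ.* d
  *-mono-≤ {a} {b} {c} {d} 0≤a 0≤d a≤b c≤d = ≤-trans
    (*-monoˡ-≤-nonNeg a {{nonNegative 0≤a}} c≤d)
    (*-monoʳ-≤-nonNeg d {{nonNegative 0≤d}} a≤b)

  0≤q-p⇒p≤q : ∀ {p q} → 0ℚ ≤ q ℚ.- p → p ≤ q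
  0≤q-p⇒p≤q {p} {q} h = subst₂ _≤_ (+-identityˡ p)
    (solve 2 (λ p q → (q :- p) :+ p := q) refl p q) (+-monoˡ-≤ p h)

  p≤q⇒0≤q-p : ∀ {p q} → p ≤ q → 0ℚ ≤ q ℚ.- p
  p≤q⇒0≤q-p {p} {q} h = subst (_≤ q ℚ.- p) (+-inverseʳ p) (+-monoˡ-≤ (ℚ.- p) h)

  0<½ : 0ℚ < ½
  0<½ = positive⁻¹ ½

  0≤1 : 0ℚ ≤ 1ℚ
  0≤1 = nonNegative⁻¹ 1ℚ

  0<1 : 0ℚ < 1ℚ
  0<1 = positive⁻¹ 1ℚ

  split : ∀ ε → ½ ℚ.* ε ℚ.+ ½ ℚ.* ε ≡ ε
  split = solve 1 (λ ε → con ½ :* ε :+ con ½ :* ε := ε) refl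

  solve-* : ∀ {b ε} → 0ℚ < b → 0ℚ < ε → ∃[ δ ] 0ℚ < δ × b ℚ.* δ ≡ ε
  solve-* {b} {ε} 0<b 0<ε = b⁻¹ ℚ.* ε , 0<*0< 0<b⁻¹ 0<ε , eq
    where
    instance
      _ = positive 0<b
      _ = pos⇒nonZero b
    b⁻¹ = 1/ b
    0<b⁻¹ : 0ℚ < b⁻¹
    0<b⁻¹ = positive⁻¹ b⁻¹ {{1/pos⇒pos b}}
    eq : b ℚ.* (b⁻¹ ℚ.* ε) ≡ ε
    eq = trans (sym (*-assoc b b⁻¹ ε)) (trans (cong (ℚ._* ε) (*-inverseʳ b)) (*-identityˡ ε))

open ℚ-Lemmas

Eventually : (ℕ → Set) → Set
Eventually P = ∃[ N ] ∀ n → N ℕ.≤ n → P n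

record ℝ : Set where
  constructor mkℝ
  field
    seq    : ℕ → ℚ
    cauchy : ∀ ε → 0ℚ < ε →
             ∃[ N ] ∀ m n → N ℕ.≤ m → N ℕ.≤ n → ∣ seq m ℚ.- seq n ∣ < ε

open ℝ public

infix 4 _≃_ _#_

_≃_ : ℝ → ℝ → Set
x ≃ y = ∀ ε → 0ℚ < ε → Eventually λ n → ∣ seq x n ℚ.- seq y n ∣ < ε

-- Apartness: the constructive form of x ≠ y, i.e. the one that makes x - y
-- invertible. Classically it is the negation of x ≃ y.
_#_ : ℝ → ℝ → Set
x # y = ∃[ ε ] 0ℚ < ε × Eventually λ n → ε ≤ ∣ seq x n ℚ.- seq y n ∣

module Bounded where
  bounded : ∀ x → ∃[ B ] 0ℚ < B × Eventually λ n → ∣ seq x n ∣ ≤ B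
  bounded x with cauchy x 1ℚ 0<1
  ... | N , h = 1ℚ ℚ.+ ∣ seq x N ∣ , 0<+0≤ 0<1 (0≤∣p∣ (seq x N)) , N , λ n N≤n → begin
    ∣ seq x n ∣                         ≡⟨ cong ∣_∣ (solve 2 (λ a b → a := (a :- b) :+ b) refl (seq x n) (seq x N)) ⟩
    ∣ seq x n ℚ.- seq x N ℚ.+ seq x N ∣   ≤⟨ ∣p+q∣≤∣p∣+∣q∣ (seq x n ℚ.- seq x N) (seq x N) ⟩
    ∣ seq x n ℚ.- seq x N ∣ ℚ.+ ∣ seq x N ∣ ≤⟨ +-monoˡ-≤ ∣ seq x N ∣ (<⇒≤ (h n N N≤n ℕₚ.≤-refl)) ⟩
    1ℚ ℚ.+ ∣ seq x N ∣ ∎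

open Bounded

fromℚ : ℚ → ℝ
fromℚ q = mkℝ (λ _ → q) λ ε 0<ε → 0 , λ _ _ _ _ →
  subst (_< ε) (sym (cong ∣_∣ (+-inverseʳ q))) 0<ε

0ℝ 1ℝ 3ℝ : ℝ
0ℝ = fromℚ 0ℚ
1ℝ = fromℚ 1ℚ
3ℝ = fromℚ (+ 3 / 1)

infixl 6 _+_ _-_
infixl 7 _*_
infix  8 -_
infix  9 _² _³

_+_ : ℝ → ℝ → ℝ
x + y = mkℝ (λ n → seq x n ℚ.+ seq y n) λ ε 0<ε →
  let 0<½ε   = 0<*0< 0<½ 0<ε
      M , hx = cauchy x (½ ℚ.* ε) 0<½ε
      N , hy = cauchy y (½ ℚ.* ε) 0<½ε
  in M ℕ.⊔ N , λ m n m≥ n≥ →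
    let a = seq x m ; b = seq x n ; c = seq y m ; d = seq y n in begin-strict
    ∣ (a ℚ.+ c) ℚ.- (b ℚ.+ d) ∣
      ≡⟨ cong ∣_∣ (solve 4 (λ a b c d → (a :+ c) :- (b :+ d) := (a :- b) :+ (c :- d)) refl a b c d) ⟩
    ∣ (a ℚ.- b) ℚ.+ (c ℚ.- d) ∣
      ≤⟨ ∣p+q∣≤∣p∣+∣q∣ (a ℚ.- b) (c ℚ.- d) ⟩
    ∣ a ℚ.- b ∣ ℚ.+ ∣ c ℚ.- d ∣
      <⟨ +-mono-< (hx m n (ℕₚ.m⊔n≤o⇒m≤o M N m≥) (ℕₚ.m⊔n≤o⇒m≤o M N n≥))
                  (hy m n (ℕₚ.m⊔n≤o⇒n≤o M N m≥) (ℕₚ.m⊔n≤o⇒n≤o M N n≥)) ⟩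
    ½ ℚ.* ε ℚ.+ ½ ℚ.* ε
      ≡⟨ split ε ⟩
    ε ∎

-_ : ℝ → ℝ
- x = mkℝ (λ n → ℚ.- seq x n) λ ε 0<ε →
  let N , h = cauchy x ε 0<ε in N , λ m n m≥ n≥ →
    subst (_< ε)
      (cong ∣_∣ (solve 2 (λ a b → b :- a := (:- a) :- (:- b)) refl (seq x m) (seq x n)))
      (h n m n≥ m≥)

_-_ : ℝ → ℝ → ℝ
x - y = x + - y

_*_ : ℝ → ℝ → ℝ
x * y = mkℝ (λ n → seq x n ℚ.* seq y n) λ ε 0<ε →
  let B , 0<B , K , hB   = bounded x
      C , 0<C , L , hC   = bounded y
      δ , 0<δ , [B+C]δ≡ε = solve-* (0<+0≤ 0<B (<⇒≤ 0<C)) 0<ε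
      M , hx             = cauchy x δ 0<δ
      N , hy             = cauchy y δ 0<δ
  in (K ℕ.⊔ L) ℕ.⊔ (M ℕ.⊔ N) , λ m n m≥ n≥ →
    let a = seq x m ; b = seq x n ; c = seq y m ; d = seq y n
        KL≤m = ℕₚ.m⊔n≤o⇒m≤o (K ℕ.⊔ L) _ m≥
        KL≤n = ℕₚ.m⊔n≤o⇒m≤o (K ℕ.⊔ L) _ n≥
        MN≤m = ℕₚ.m⊔n≤o⇒n≤o (K ℕ.⊔ L) _ m≥
        MN≤n = ℕₚ.m⊔n≤o⇒n≤o (K ℕ.⊔ L) _ n≥
    in begin-strict
    ∣ a ℚ.* c ℚ.- b ℚ.* d ∣
      ≡⟨ cong ∣_∣ (solve 4 (λ a b c d → a :* c :- b :* d := a :* (c :- d) :+ d :* (a :- b)) refl a b c d) ⟩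
    ∣ a ℚ.* (c ℚ.- d) ℚ.+ d ℚ.* (a ℚ.- b) ∣
      ≤⟨ ∣p+q∣≤∣p∣+∣q∣ (a ℚ.* (c ℚ.- d)) (d ℚ.* (a ℚ.- b)) ⟩
    ∣ a ℚ.* (c ℚ.- d) ∣ ℚ.+ ∣ d ℚ.* (a ℚ.- b) ∣
      ≡⟨ cong₂ ℚ._+_ (∣p*q∣≡∣p∣*∣q∣ a (c ℚ.- d)) (∣p*q∣≡∣p∣*∣q∣ d (a ℚ.- b)) ⟩
    ∣ a ∣ ℚ.* ∣ c ℚ.- d ∣ ℚ.+ ∣ d ∣ ℚ.* ∣ a ℚ.- b ∣
      ≤⟨ +-mono-≤
           (*-monoʳ-≤-nonNeg ∣ c ℚ.- d ∣ {{∣-∣-nonNeg (c ℚ.- d)}} (hB m (ℕₚ.m⊔n≤o⇒m≤o K L KL≤m)))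
           (*-monoʳ-≤-nonNeg ∣ a ℚ.- b ∣ {{∣-∣-nonNeg (a ℚ.- b)}} (hC n (ℕₚ.m⊔n≤o⇒n≤o K L KL≤n))) ⟩
    B ℚ.* ∣ c ℚ.- d ∣ ℚ.+ C ℚ.* ∣ a ℚ.- b ∣
      <⟨ +-mono-<
           (*-monoʳ-<-pos B {{positive 0<B}} (hy m n (ℕₚ.m⊔n≤o⇒n≤o M N MN≤m) (ℕₚ.m⊔n≤o⇒n≤o M N MN≤n)))
           (*-monoʳ-<-pos C {{positive 0<C}} (hx m n (ℕₚ.m⊔n≤o⇒m≤o M N MN≤m) (ℕₚ.m⊔n≤o⇒m≤o M N MN≤n))) ⟩
    B ℚ.* δ ℚ.+ C ℚ.* δ
      ≡⟨ sym (*-distribʳ-+ δ B C) ⟩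
    (B ℚ.+ C) ℚ.* δ
      ≡⟨ [B+C]δ≡ε ⟩
    ε ∎

_² _³ : ℝ → ℝ
x ² = x * x
x ³ = x * x * x

module CubeRootApproximation where
  cube : ℚ → ℚ
  cube a = a ℚ.* a ℚ.* a

  4ℚ : ℚ
  4ℚ = + 4 / 1

  0≤cube : ∀ {a} → 0ℚ ≤ a → 0ℚ ≤ cube a
  0≤cube 0≤a = 0≤*0≤ (0≤*0≤ 0≤a 0≤a) 0≤a

  0≤sq : ∀ a → 0ℚ ≤ a ℚ.* a
  0≤sq a with ≤-total 0ℚ a
  ... | inj₁ 0≤a = 0≤*0≤ 0≤a 0≤a
  ... | inj₂ a≤0 = nonNegative⁻¹ (a ℚ.* a)
    {{nonPos*nonPos⇒nonPos a {{ℚ.nonPositive a≤0}} a {{ℚ.nonPositive a≤0}}}}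

  cube-gap : ∀ {x y} → y ≤ x → cube (x ℚ.- y) ≤ 4ℚ ℚ.* (cube x ℚ.- cube y)
  cube-gap {x} {y} y≤x = 0≤q-p⇒p≤q $ subst (0ℚ ≤_)
    (solve 2 (λ x y →
        con (+ 3 / 1) :* ((x :- y) :* ((x :+ y) :* (x :+ y)))
        := con 4ℚ :* (x :* x :* x :- y :* y :* y) :- (x :- y) :* (x :- y) :* (x :- y))
      refl x y)
    (0≤*0≤ (nonNegative⁻¹ (+ 3 / 1)) (0≤*0≤ (p≤q⇒0≤q-p y≤x) (0≤sq (x ℚ.+ y))))

  cube-mono : ∀ {x y} → y ≤ x → cube y ≤ cube x
  cube-mono {x} {y} y≤x = 0≤q-p⇒p≤q $ *-cancelˡ-≤-pos 4ℚ $
    ≤-trans (≤-reflexive (*-zeroʳ 4ℚ)) (≤-trans (0≤cube (p≤q⇒0≤q-p y≤x)) (cube-gap y≤x))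

  ½^_ : ℕ → ℚ
  ½^ zero  = 1ℚ
  ½^ suc n = ½ ℚ.* ½^ n

  0<½^ : ∀ n → 0ℚ < ½^ n
  0<½^ zero    = 0<1
  0<½^ (suc n) = 0<*0< 0<½ (0<½^ n)

  -- Starting from a³ ≤ q < (a + w)³, halve the bracketing interval n times
  -- and return its left end.
  bisect : ℚ → ℕ → ℚ → ℚ → ℚ
  bisect q zero    a w = a
  bisect q (suc n) a w with cube (a ℚ.+ w ℚ.* ½) ≤? q
  ... | yes _ = bisect q n (a ℚ.+ w ℚ.* ½) (w ℚ.* ½)
  ... | no  _ = bisect q n a (w ℚ.* ½)

  bisect-spec : ∀ q n a w → cube a ≤ q → q < cube (a ℚ.+ w) →
                cube (bisect q n a w) ≤ q × q < cube (bisect q n a w ℚ.+ w ℚ.* ½^ n)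
  bisect-spec q zero a w lo hi = lo , subst (λ v → q < cube (a ℚ.+ v)) (sym (*-identityʳ w)) hi
  bisect-spec q (suc n) a w lo hi with cube (a ℚ.+ w ℚ.* ½) ≤? q
  ... | yes lo′ =
    let l , h = bisect-spec q n (a ℚ.+ w ℚ.* ½) (w ℚ.* ½) lo′
                  (subst (λ v → q < cube v)
                    (solve 2 (λ a w → a :+ w := (a :+ w :* con ½) :+ w :* con ½) refl a w) hi)
    in l , subst (λ v → q < cube (bisect q n (a ℚ.+ w ℚ.* ½) (w ℚ.* ½) ℚ.+ v)) (*-assoc w ½ (½^ n)) h
  ... | no  hi′ =
    let l , h = bisect-spec q n a (w ℚ.* ½) lo (≰⇒> hi′)
    in l , subst (λ v → q < cube (bisect q n a (w ℚ.* ½) ℚ.+ v)) (*-assoc w ½ (½^ n)) h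

  radius : ℚ → ℚ
  radius q = 1ℚ ℚ.+ ∣ q ∣

  width : ℚ → ℕ → ℚ
  width q n = (radius q ℚ.+ radius q) ℚ.* ½^ n

  cbrt-approx : ℚ → ℕ → ℚ
  cbrt-approx q n = bisect q n (ℚ.- radius q) (radius q ℚ.+ radius q)

  1≤radius : ∀ q → 1ℚ ≤ radius q
  1≤radius q = ≤-trans (≤-reflexive (sym (+-identityʳ 1ℚ))) (+-monoʳ-≤ 1ℚ (0≤∣p∣ q))

  0≤radius : ∀ q → 0ℚ ≤ radius q
  0≤radius q = ≤-trans 0≤1 (1≤radius q)

  0≤2radius : ∀ q → 0ℚ ≤ radius q ℚ.+ radius q
  0≤2radius q = +-mono-≤ (0≤radius q) (0≤radius q)

  ∣q∣<cube-radius : ∀ q → ∣ q ∣ < cube (radius q)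
  ∣q∣<cube-radius q = begin-strict
    ∣ q ∣                      ≡⟨ sym (+-identityˡ ∣ q ∣) ⟩
    0ℚ ℚ.+ ∣ q ∣                <⟨ +-monoˡ-< ∣ q ∣ 0<1 ⟩
    t                          ≡⟨ sym (trans (cong (ℚ._* t) (*-identityˡ 1ℚ)) (*-identityˡ t)) ⟩
    1ℚ ℚ.* 1ℚ ℚ.* t              ≤⟨ *-mono-≤ (0≤*0≤ 0≤1 0≤1) (0≤radius q)
                                   (*-mono-≤ 0≤1 (0≤radius q) (1≤radius q) (1≤radius q)) ≤-refl ⟩
    cube t ∎
    where t = radius q

  cbrt-approx-spec : ∀ q n → cube (cbrt-approx q n) ≤ q × q < cube (cbrt-approx q n ℚ.+ width q n)
  cbrt-approx-spec q n = bisect-spec q n (ℚ.- t) (t ℚ.+ t) lo hi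
    where
    t = radius q
    lo : cube (ℚ.- t) ≤ q
    lo = begin
      cube (ℚ.- t)  ≡⟨ solve 1 (λ t → (:- t) :* (:- t) :* (:- t) := :- (t :* t :* t)) refl t ⟩
      ℚ.- cube t    ≤⟨ neg-antimono-≤ (<⇒≤ (∣q∣<cube-radius q)) ⟩
      ℚ.- ∣ q ∣     ≤⟨ -∣p∣≤p q ⟩
      q ∎
    hi : q < cube (ℚ.- t ℚ.+ (t ℚ.+ t))
    hi = begin-strict
      q                         ≤⟨ p≤∣p∣ q ⟩
      ∣ q ∣                     <⟨ ∣q∣<cube-radius q ⟩
      cube t                    ≡⟨ cong cube (solve 1 (λ t → t := :- t :+ (t :+ t)) refl t) ⟩
      cube (ℚ.- t ℚ.+ (t ℚ.+ t)) ∎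

  ι : ℕ → ℚ
  ι n = + n / 1

  toℚᵘ-ι : ∀ n → toℚᵘ (ι n) ℚᵘ.≃ ℚᵘ.mkℚᵘ (+ n) 0
  toℚᵘ-ι n = toℚᵘ-fromℚᵘ (ℚᵘ.mkℚᵘ (+ n) 0)

  ι-suc : ∀ n → ι (suc n) ≡ 1ℚ ℚ.+ ι n
  ι-suc n = toℚᵘ-injective (ℚᵘₚ.≃-trans (toℚᵘ-ι (suc n)) (ℚᵘₚ.≃-sym
    (ℚᵘₚ.≃-trans (toℚᵘ-homo-+ 1ℚ (ι n))
    (ℚᵘₚ.≃-trans (ℚᵘₚ.+-congʳ (toℚᵘ 1ℚ) (toℚᵘ-ι n))
      (ℚᵘ.*≡* (cong (λ k → (+ 1 ℤ.+ k) ℤ.* + 1) (ℤₚ.*-identityʳ (+ n))))))))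
    where import Data.Integer.Base as ℤ

  0≤ι : ∀ n → 0ℚ ≤ ι n
  0≤ι zero    = ≤-refl
  0≤ι (suc n) = subst (0ℚ ≤_) (sym (ι-suc n)) (+-mono-≤ 0≤1 (0≤ι n))

  archimedean : ∀ ε → 0ℚ < ε → ∃[ n ] 1ℚ ≤ ε ℚ.* ι n
  archimedean ε@(mkℚ +[1+ a ] d-1 _) _ = suc d-1 , toℚᵘ-cancel-≤
    (ℚᵘₚ.≤-trans
      (ℚᵘ.*≤* (+≤+ le))
      (ℚᵘₚ.≤-reflexive (ℚᵘₚ.≃-sym (ℚᵘₚ.≃-trans (toℚᵘ-homo-* ε (ι (suc d-1)))
        (ℚᵘₚ.*-congˡ {toℚᵘ ε} (toℚᵘ-ι (suc d-1)))))))
    where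
    le : 1 ℕ.* (suc d-1 ℕ.* 1) ℕ.≤ suc a ℕ.* suc d-1 ℕ.* 1
    le = ℕₚ.≤-trans (ℕₚ.≤-reflexive (ℕₚ.*-identityˡ _))
      (ℕₚ.*-monoˡ-≤ 1 (ℕₚ.m≤m+n (suc d-1) (a ℕ.* suc d-1)))
  archimedean (mkℚ (+ 0)    _ _) 0<ε = contradiction (positive 0<ε) λ ()
  archimedean (mkℚ -[1+ _ ] _ _) 0<ε = contradiction (positive 0<ε) λ ()

  ½^*suc≤1 : ∀ n → ½^ n ℚ.* (1ℚ ℚ.+ ι n) ≤ 1ℚ
  ½^*suc≤1 zero    = ≤-refl
  ½^*suc≤1 (suc n) = begin
    ½ ℚ.* ½^ n ℚ.* (1ℚ ℚ.+ ι (suc n))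
      ≡⟨ cong (λ k → ½ ℚ.* ½^ n ℚ.* (1ℚ ℚ.+ k)) (ι-suc n) ⟩
    ½ ℚ.* ½^ n ℚ.* (1ℚ ℚ.+ (1ℚ ℚ.+ ι n))
      ≤⟨ *-monoˡ-≤-nonNeg (½ ℚ.* ½^ n) {{nonNegative (<⇒≤ (0<½^ (suc n)))}}
           (+-monoʳ-≤ 1ℚ (subst (_≤ (1ℚ ℚ.+ ι n) ℚ.+ ι n) (+-identityʳ (1ℚ ℚ.+ ι n)) (+-monoʳ-≤ (1ℚ ℚ.+ ι n) (0≤ι n)))) ⟩
    ½ ℚ.* ½^ n ℚ.* (1ℚ ℚ.+ (1ℚ ℚ.+ ι n ℚ.+ ι n))
      ≡⟨ solve 2 (λ h k → con ½ :* h :* (con 1ℚ :+ (con 1ℚ :+ k :+ k)) := h :* (con 1ℚ :+ k)) refl (½^ n) (ι n) ⟩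
    ½^ n ℚ.* (1ℚ ℚ.+ ι n)
      ≤⟨ ½^*suc≤1 n ⟩
    1ℚ ∎

  ½^-anti : ∀ n k → ½^ (k ℕ.+ n) ≤ ½^ n
  ½^-anti n zero    = ≤-refl
  ½^-anti n (suc k) = ≤-trans
    (subst (½ ℚ.* ½^ (k ℕ.+ n) ≤_) (*-identityˡ (½^ (k ℕ.+ n)))
      (*-monoʳ-≤-nonNeg (½^ (k ℕ.+ n)) {{nonNegative (<⇒≤ (0<½^ (k ℕ.+ n)))}} (≤ᵇ⇒≤ {½} {1ℚ} _)))
    (½^-anti n k)

  ½^→0 : ∀ ε → 0ℚ < ε → Eventually λ n → ½^ n < ε
  ½^→0 ε 0<ε with archimedean ε 0<ε
  ... | N , 1≤εN = N , λ n N≤n → ≤-<-trans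
      (subst (λ k → ½^ k ≤ ½^ N) (ℕₚ.m∸n+n≡m N≤n) (½^-anti N (n ℕ.∸ N))) small
    where
    small : ½^ N < ε
    small = *-cancelʳ-<-nonNeg (1ℚ ℚ.+ ι N) {{nonNegative (+-mono-≤ 0≤1 (0≤ι N))}} $ begin-strict
      ½^ N ℚ.* (1ℚ ℚ.+ ι N)   ≤⟨ ½^*suc≤1 N ⟩
      1ℚ                    ≡⟨ sym (+-identityˡ 1ℚ) ⟩
      0ℚ ℚ.+ 1ℚ              <⟨ +-mono-<-≤ 0<ε 1≤εN ⟩
      ε ℚ.+ ε ℚ.* ι N         ≡⟨ solve 2 (λ e k → e :+ e :* k := e :* (con 1ℚ :+ k)) refl ε (ι N) ⟩
      ε ℚ.* (1ℚ ℚ.+ ι N) ∎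

  width→0 : ∀ x ε → 0ℚ < ε → Eventually λ n → width (seq x n) n < ε
  width→0 x ε 0<ε =
    let B , 0<B , K , hB = bounded x
        R                = 1ℚ ℚ.+ B
        0<R              = 0<+0≤ 0<1 (<⇒≤ 0<B)
        0<2R             = 0<+0≤ 0<R (<⇒≤ 0<R)
        δ , 0<δ , 2Rδ≡ε  = solve-* 0<2R 0<ε
        L , hL           = ½^→0 δ 0<δ
    in K ℕ.⊔ L , λ n n≥ →
      let r≤R = +-monoʳ-≤ 1ℚ (hB n (ℕₚ.m⊔n≤o⇒m≤o K L n≥)) in begin-strict
      width (seq x n) n   ≤⟨ *-monoʳ-≤-nonNeg (½^ n) {{nonNegative (<⇒≤ (0<½^ n))}} (+-mono-≤ r≤R r≤R) ⟩
      (R ℚ.+ R) ℚ.* ½^ n    <⟨ *-monoʳ-<-pos (R ℚ.+ R) {{positive 0<2R}} (hL n (ℕₚ.m⊔n≤o⇒n≤o K L n≥)) ⟩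
      (R ℚ.+ R) ℚ.* δ       ≡⟨ 2Rδ≡ε ⟩
      ε ∎

  0≤width : ∀ q n → 0ℚ ≤ width q n
  0≤width q n = 0≤*0≤ (0≤2radius q) (<⇒≤ (0<½^ n))

open CubeRootApproximation

cbrt : ℝ → ℝ
cbrt x = mkℝ c λ ε 0<ε →
  let η             = ½ ℚ.* ε
      0<η           = 0<*0< 0<½ 0<ε
      δ , 0<δ , 4δ≡ = solve-* (positive⁻¹ 4ℚ) (0<*0< (0<*0< 0<η 0<η) 0<η)
      M , hx        = cauchy x δ 0<δ
      N , hw        = width→0 x η 0<η
      one-sided : ∀ m n → M ℕ.⊔ N ℕ.≤ m → M ℕ.⊔ N ℕ.≤ n → c m ℚ.- c n < ε
      one-sided m n m≥ n≥ = ≰⇒> λ ε≤ →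
        let v    = c n ℚ.+ width (seq x n) n
            η≤   : η ≤ c m ℚ.- v
            η≤   = begin
              η                                       ≡⟨ solve 1 (λ e → con ½ :* e := e :- con ½ :* e) refl ε ⟩
              ε ℚ.- η                                  ≤⟨ +-mono-≤ ε≤ (neg-antimono-≤ (<⇒≤ (hw n (ℕₚ.m⊔n≤o⇒n≤o M N n≥)))) ⟩
              c m ℚ.- c n ℚ.- width (seq x n) n         ≡⟨ solve 3 (λ a b w → a :- b :- w := a :- (b :+ w)) refl (c m) (c n) (width (seq x n) n) ⟩
              c m ℚ.- v ∎
            v≤   : v ≤ c m
            v≤   = 0≤q-p⇒p≤q (≤-trans (<⇒≤ 0<η) η≤)
            lo , _ = cbrt-approx-spec (seq x m) m
            _ , hi = cbrt-approx-spec (seq x n) n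
        in <-irrefl refl $ begin-strict
          cube η                         ≤⟨ cube-mono η≤ ⟩
          cube (c m ℚ.- v)                ≤⟨ cube-gap v≤ ⟩
          4ℚ ℚ.* (cube (c m) ℚ.- cube v)   ≤⟨ *-monoˡ-≤-nonNeg 4ℚ (+-mono-≤ lo (neg-antimono-≤ (<⇒≤ hi))) ⟩
          4ℚ ℚ.* (seq x m ℚ.- seq x n)     <⟨ *-monoʳ-<-pos 4ℚ (p<ε⇐∣p∣<ε (hx m n (ℕₚ.m⊔n≤o⇒m≤o M N m≥) (ℕₚ.m⊔n≤o⇒m≤o M N n≥))) ⟩
          4ℚ ℚ.* δ                        ≡⟨ 4δ≡ ⟩
          cube η ∎
  in M ℕ.⊔ N , λ m n m≥ n≥ → ∣p∣<-intro (one-sided m n m≥ n≥)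
       (subst (_< ε) (solve 2 (λ a b → b :- a := :- (a :- b)) refl (c m) (c n)) (one-sided n m n≥ m≥))
  where
  c : ℕ → ℚ
  c n = cbrt-approx (seq x n) n

cbrt-³ : ∀ x → cbrt x ³ ≃ x
cbrt-³ x ε 0<ε =
  let C , 0<C , K , hC = bounded (cbrt x)
      D                = C ℚ.+ 1ℚ
      0<D              = 0<+0≤ 0<C 0≤1
      0<D²             = 0<*0< 0<D 0<D
      0<3D²            = 0<+0≤ (0<+0≤ 0<D² (<⇒≤ 0<D²)) (<⇒≤ 0<D²)
      δ , 0<δ , 3D²δ≡ε = solve-* 0<3D² 0<ε
      L , h1           = width→0 x 1ℚ 0<1
      M , hδ           = width→0 x δ 0<δ
  in K ℕ.⊔ (L ℕ.⊔ M) , λ n n≥ →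
    let LM≤n    = ℕₚ.m⊔n≤o⇒n≤o K (L ℕ.⊔ M) n≥
        q       = seq x n
        u       = seq (cbrt x) n
        w       = width q n
        v       = u ℚ.+ w
        0≤w     = 0≤width q n
        ∣w∣≡w   = 0≤p⇒∣p∣≡p 0≤w
        lo , hi = cbrt-approx-spec q n
        u≤C : ∣ u ∣ ≤ C
        u≤C = hC n (ℕₚ.m⊔n≤o⇒m≤o K (L ℕ.⊔ M) n≥)
        u≤D : ∣ u ∣ ≤ D
        u≤D = ≤-trans u≤C (subst (_≤ D) (+-identityʳ C) (+-monoʳ-≤ C 0≤1))
        v≤D : ∣ v ∣ ≤ D
        v≤D = ≤-trans (∣p+q∣≤∣p∣+∣q∣ u w)
          (+-mono-≤ u≤C (subst (_≤ 1ℚ) (sym ∣w∣≡w) (<⇒≤ (h1 n (ℕₚ.m⊔n≤o⇒m≤o L M LM≤n)))))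
        prod : ∀ a b → ∣ a ∣ ≤ D → ∣ b ∣ ≤ D → ∣ a ℚ.* b ∣ ≤ D ℚ.* D
        prod a b ha hb = ≤-trans (≤-reflexive (∣p*q∣≡∣p∣*∣q∣ a b))
          (*-mono-≤ (0≤∣p∣ a) (<⇒≤ 0<D) ha hb)
    in begin-strict
    ∣ cube u ℚ.- q ∣
      ≡⟨ ∣-∣-flip (cube u) q ⟩
    ∣ q ℚ.- cube u ∣
      ≡⟨ 0≤p⇒∣p∣≡p (p≤q⇒0≤q-p lo) ⟩
    q ℚ.- cube u
      ≤⟨ +-monoˡ-≤ (ℚ.- cube u) (<⇒≤ hi) ⟩
    cube v ℚ.- cube u
      ≡⟨ solve 2 (λ u w → let v = u :+ w in
           v :* v :* v :- u :* u :* u := (v :* v :+ u :* v :+ u :* u) :* w) refl u w ⟩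
    (v ℚ.* v ℚ.+ u ℚ.* v ℚ.+ u ℚ.* u) ℚ.* w
      ≤⟨ *-monoʳ-≤-nonNeg w {{nonNegative 0≤w}} (≤-trans (p≤∣p∣ _)
           (≤-trans (∣p+q∣≤∣p∣+∣q∣ (v ℚ.* v ℚ.+ u ℚ.* v) (u ℚ.* u))
           (+-mono-≤ (≤-trans (∣p+q∣≤∣p∣+∣q∣ (v ℚ.* v) (u ℚ.* v))
                       (+-mono-≤ (prod v v v≤D v≤D) (prod u v u≤D v≤D)))
                     (prod u u u≤D u≤D)))) ⟩
    (D ℚ.* D ℚ.+ D ℚ.* D ℚ.+ D ℚ.* D) ℚ.* w
      <⟨ *-monoʳ-<-pos (D ℚ.* D ℚ.+ D ℚ.* D ℚ.+ D ℚ.* D) {{positive 0<3D²}} (hδ n (ℕₚ.m⊔n≤o⇒n≤o L M LM≤n)) ⟩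
    (D ℚ.* D ℚ.+ D ℚ.* D ℚ.+ D ℚ.* D) ℚ.* δ
      ≡⟨ 3D²δ≡ε ⟩
    ε ∎

record ℂ : Set where
  constructor _+i_
  field
    re im : ℝ

open ℂ public

infix 4 _≃ᶜ_

_≃ᶜ_ : ℂ → ℂ → Set
z ≃ᶜ w = re z ≃ re w × im z ≃ im w

fromℝ : ℝ → ℂ
fromℝ x = x +i 0ℝ

infixl 6 _+ᶜ_
infixl 7 _*ᶜ_

_+ᶜ_ _*ᶜ_ : ℂ → ℂ → ℂ
z +ᶜ w = (re z + re w) +i (im z + im w)
z *ᶜ w = (re z * re w - im z * im w) +i (re z * im w + im z * re w)

IsReal : ℂ → Set
IsReal z = im z ≃ 0ℝ

infix 5 x³+_x²+_x+_

record MonicCubic : Set where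
  constructor x³+_x²+_x+_
  field
    p q r : ℝ

-- Equality of formal polynomials.
infix 4 _≈_

_≈_ : MonicCubic → MonicCubic → Set
(x³+ p x²+ q x+ r) ≈ (x³+ p′ x²+ q′ x+ r′) = p ≃ p′ × q ≃ q′ × r ≃ r′

eval : MonicCubic → ℂ → ℂ
eval (x³+ p x²+ q x+ r) z =
  z *ᶜ z *ᶜ z +ᶜ fromℝ p *ᶜ (z *ᶜ z) +ᶜ fromℝ q *ᶜ z +ᶜ fromℝ r

IsZero : MonicCubic → ℂ → Set
IsZero f z = eval f z ≃ᶜ fromℝ 0ℝ

record IsRCP (f : MonicCubic) : Set where
  open MonicCubic f
  field
    r#0        : r # 0ℝ
    zeros-real : ∀ z → IsZero f z → IsReal z
    relation   : p * cbrt r + 3ℝ * (cbrt r) ² + q ≃ 0ℝ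

ρ : ℝ → ℝ → MonicCubic
ρ h s = x³+ h * s x²+ - ((h + 3ℝ) * s ²) x+ s ³

{-# OPTIONS --safe #-}

-- Write ρ(h,s,x) = N(x) + h s M(x) with N = x³ − 3s²x + s³ and M = x² − s x.
-- If z = a + b i is a zero, then h s |M(z)|² = − N(z) M̄(z), so N(z) M̄(z) is real;
-- its imaginary part is b ((a² + b² + s² − s a)² + (s b)²), and the second factor
-- is at least (¾ s²)² because a² + b² + s² − s a = (a − s/2)² + b² + ¾ s².
-- Hence b = 0 as soon as s ≠ 0.
-- The coefficient relation of an RCP is the shape of ρ, with s = r^{1/3} and h = p / s.

module Submission where

open import Defs
open import Data.Integer.Base using (+_)
open import Data.Nat.Base as ℕ using (ℕ)
import Data.Nat.Properties as ℕₚ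
open import Data.Product using (∃-syntax; _×_; _,_; proj₁)
open import Data.Rational using (ℚ; 0ℚ; 1ℚ; ½; 1/_; _/_; ∣_∣; _≤_; _<_; _≟_;
  positive; nonNegative; ≢-nonZero)
import Data.Rational as ℚ
open import Data.Rational.Properties hiding (≃-sym)
open import Data.Rational.Solver
open import Function.Bundles using (_⇔_; mk⇔)
open import Relation.Binary.Bundles using (Setoid)
open import Relation.Binary.PropositionalEquality
  using (_≡_; _≢_; refl; sym; trans; cong; cong₂; subst)
import Relation.Binary.Reasoning.Setoid as ≈-Reasoning
open import Relation.Nullary using (yes; no; contradiction)

open ℚ-Lemmas
open Bounded
open CubeRootApproximation using (0≤sq)
open +-*-Solver using (solve; _:=_; _:+_; _:*_; _:-_; :-_; con)

-- Equality of reals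

-- Operations on `ℝ` act termwise, so this carries every identity that the rational ring solver
-- proves over to the reals.
≗⇒≃ : ∀ {x y} → (∀ n → seq x n ≡ seq y n) → x ≃ y
≗⇒≃ {x} {y} x≗y ε 0<ε = 0 , λ n _ → subst (_< ε)
  (sym (cong ∣_∣ (trans (cong (ℚ._- seq y n) (x≗y n)) (+-inverseʳ (seq y n))))) 0<ε

≃-refl : ∀ {x} → x ≃ x
≃-refl {x} = ≗⇒≃ {x} {x} λ _ → refl

≃-sym : ∀ {x y} → x ≃ y → y ≃ x
≃-sym {x} {y} x≃y ε 0<ε =
  let N , h = x≃y ε 0<ε
  in N , λ n n≥ → subst (_< ε) (∣-∣-flip (seq x n) (seq y n)) (h n n≥)

+-cong : ∀ {x x′ y y′} → x ≃ x′ → y ≃ y′ → x + y ≃ x′ + y′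
+-cong {x} {x′} {y} {y′} x≃x′ y≃y′ ε 0<ε =
  let 0<½ε   = 0<*0< 0<½ 0<ε
      M , hx = x≃x′ (½ ℚ.* ε) 0<½ε
      N , hy = y≃y′ (½ ℚ.* ε) 0<½ε
  in M ℕ.⊔ N , λ n n≥ →
    let a = seq x n ; b = seq x′ n ; c = seq y n ; d = seq y′ n in begin-strict
    ∣ (a ℚ.+ c) ℚ.- (b ℚ.+ d) ∣
      ≡⟨ cong ∣_∣ (solve 4 (λ a b c d → (a :+ c) :- (b :+ d) := (a :- b) :+ (c :- d)) refl a b c d) ⟩
    ∣ (a ℚ.- b) ℚ.+ (c ℚ.- d) ∣
      ≤⟨ ∣p+q∣≤∣p∣+∣q∣ (a ℚ.- b) (c ℚ.- d) ⟩
    ∣ a ℚ.- b ∣ ℚ.+ ∣ c ℚ.- d ∣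
      <⟨ +-mono-< (hx n (ℕₚ.m⊔n≤o⇒m≤o M N n≥)) (hy n (ℕₚ.m⊔n≤o⇒n≤o M N n≥)) ⟩
    ½ ℚ.* ε ℚ.+ ½ ℚ.* ε
      ≡⟨ split ε ⟩
    ε ∎
  where open ≤-Reasoning

-- Adding the two hypotheses with `+-cong` gives `x + y ≃ y + z`, and `y` cancels in the termwise
-- difference.
≃-trans : ∀ {x y z} → x ≃ y → y ≃ z → x ≃ z
≃-trans {x} {y} {z} x≃y y≃z ε 0<ε =
  let N , h = +-cong {x} {y} {y} {z} x≃y y≃z ε 0<ε
  in N , λ n n≥ → subst (_< ε)
    (cong ∣_∣ (solve 3 (λ a b c → (a :+ b) :- (b :+ c) := a :- c) refl (seq x n) (seq y n) (seq z n)))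
    (h n n≥)

≃-setoid : Setoid _ _
≃-setoid = record
  { Carrier = ℝ
  ; _≈_ = _≃_
  ; isEquivalence = record
    { refl  = λ {x} → ≃-refl {x}
    ; sym   = λ {x} {y} → ≃-sym {x} {y}
    ; trans = λ {x} {y} {z} → ≃-trans {x} {y} {z}
    }
  }

neg-cong : ∀ {x y} → x ≃ y → - x ≃ - y
neg-cong {x} {y} x≃y ε 0<ε =
  let N , h = ≃-sym {x} {y} x≃y ε 0<ε
  in N , λ n n≥ → subst (_< ε)
    (cong ∣_∣ (solve 2 (λ a b → b :- a := (:- a) :- (:- b)) refl (seq x n) (seq y n))) (h n n≥)

*-congʳ : ∀ {x y} z → x ≃ y → x * z ≃ y * z
*-congʳ {x} {y} z x≃y ε 0<ε =
  let B , 0<B , K , hB = bounded z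
      δ , 0<δ , Bδ≡ε   = solve-* 0<B 0<ε
      M , h            = x≃y δ 0<δ
  in K ℕ.⊔ M , λ n n≥ →
    let a = seq x n ; b = seq y n ; c = seq z n in begin-strict
    ∣ a ℚ.* c ℚ.- b ℚ.* c ∣
      ≡⟨ cong ∣_∣ (solve 3 (λ a b c → a :* c :- b :* c := c :* (a :- b)) refl a b c) ⟩
    ∣ c ℚ.* (a ℚ.- b) ∣
      ≡⟨ ∣p*q∣≡∣p∣*∣q∣ c (a ℚ.- b) ⟩
    ∣ c ∣ ℚ.* ∣ a ℚ.- b ∣
      ≤⟨ *-monoʳ-≤-nonNeg ∣ a ℚ.- b ∣ {{∣-∣-nonNeg (a ℚ.- b)}} (hB n (ℕₚ.m⊔n≤o⇒m≤o K M n≥)) ⟩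
    B ℚ.* ∣ a ℚ.- b ∣
      <⟨ *-monoʳ-<-pos B {{positive 0<B}} (h n (ℕₚ.m⊔n≤o⇒n≤o K M n≥)) ⟩
    B ℚ.* δ
      ≡⟨ Bδ≡ε ⟩
    ε ∎
  where open ≤-Reasoning

*-commutes : ∀ x y → x * y ≃ y * x
*-commutes x y = ≗⇒≃ {x * y} {y * x} λ n → *-comm (seq x n) (seq y n)

*-cong : ∀ {x x′ y y′} → x ≃ x′ → y ≃ y′ → x * y ≃ x′ * y′
*-cong {x} {x′} {y} {y′} x≃x′ y≃y′ = begin
  x * y    ≈⟨ *-congʳ {x} {x′} y x≃x′ ⟩
  x′ * y   ≈⟨ *-commutes x′ y ⟩
  y * x′   ≈⟨ *-congʳ {y} {y′} x′ y≃y′ ⟩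
  y′ * x′  ≈⟨ *-commutes y′ x′ ⟩
  x′ * y′  ∎
  where open ≈-Reasoning ≃-setoid

-- Apartness from zero

∣p-0∣≡∣p∣ : ∀ p → ∣ p ℚ.- 0ℚ ∣ ≡ ∣ p ∣
∣p-0∣≡∣p∣ p = cong ∣_∣ (+-identityʳ p)

-- Reverse triangle inequality: once the terms `a` of `x` and `b` of `y` differ by less than half
-- the gap ε, |b| ≥ |a| - |a - b| leaves the other half.
#0-resp-≃ : ∀ {x y} → x ≃ y → x # 0ℝ → y # 0ℝ
#0-resp-≃ {x} {y} x≃y (ε , 0<ε , M , hx) =
  let N , h = x≃y (½ ℚ.* ε) (0<*0< 0<½ 0<ε)
  in ½ ℚ.* ε , 0<*0< 0<½ 0<ε , M ℕ.⊔ N , λ n n≥ →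
    let a = seq x n ; b = seq y n in begin
    ½ ℚ.* ε
      ≡⟨ solve 1 (λ e → con ½ :* e := e :- con ½ :* e) refl ε ⟩
    ε ℚ.- ½ ℚ.* ε
      ≤⟨ +-mono-≤ (subst (ε ≤_) (∣p-0∣≡∣p∣ a) (hx n (ℕₚ.m⊔n≤o⇒m≤o M N n≥)))
                  (neg-antimono-≤ (<⇒≤ (h n (ℕₚ.m⊔n≤o⇒n≤o M N n≥)))) ⟩
    ∣ a ∣ ℚ.- ∣ a ℚ.- b ∣
      ≡⟨ cong (λ u → ∣ u ∣ ℚ.- ∣ a ℚ.- b ∣) (solve 2 (λ a b → a := (a :- b) :+ b) refl a b) ⟩
    ∣ (a ℚ.- b) ℚ.+ b ∣ ℚ.- ∣ a ℚ.- b ∣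
      ≤⟨ +-monoˡ-≤ (ℚ.- ∣ a ℚ.- b ∣) (∣p+q∣≤∣p∣+∣q∣ (a ℚ.- b) b) ⟩
    ∣ a ℚ.- b ∣ ℚ.+ ∣ b ∣ ℚ.- ∣ a ℚ.- b ∣
      ≡⟨ solve 2 (λ u v → u :+ v :- u := v) refl ∣ a ℚ.- b ∣ ∣ b ∣ ⟩
    ∣ b ∣
      ≡⟨ sym (∣p-0∣≡∣p∣ b) ⟩
    ∣ b ℚ.- 0ℚ ∣ ∎
  where open ≤-Reasoning

#0-*-#0 : ∀ {x y} → x # 0ℝ → y # 0ℝ → x * y # 0ℝ
#0-*-#0 {x} {y} (δ , 0<δ , M , hx) (ε , 0<ε , N , hy) =
  δ ℚ.* ε , 0<*0< 0<δ 0<ε , M ℕ.⊔ N , λ n n≥ →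
    let a = seq x n ; b = seq y n in begin
    δ ℚ.* ε
      ≤⟨ *-mono-≤ (<⇒≤ 0<δ) (0≤∣p∣ (b ℚ.- 0ℚ)) (hx n (ℕₚ.m⊔n≤o⇒m≤o M N n≥)) (hy n (ℕₚ.m⊔n≤o⇒n≤o M N n≥)) ⟩
    ∣ a ℚ.- 0ℚ ∣ ℚ.* ∣ b ℚ.- 0ℚ ∣
      ≡⟨ sym (∣p*q∣≡∣p∣*∣q∣ (a ℚ.- 0ℚ) (b ℚ.- 0ℚ)) ⟩
    ∣ (a ℚ.- 0ℚ) ℚ.* (b ℚ.- 0ℚ) ∣
      ≡⟨ cong ∣_∣ (solve 2 (λ a b → (a :- con 0ℚ) :* (b :- con 0ℚ) := a :* b :- con 0ℚ) refl a b) ⟩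
    ∣ a ℚ.* b ℚ.- 0ℚ ∣ ∎
  where open ≤-Reasoning

-- If |x| ≤ B eventually, then ε ≤ |x||y| ≤ B|y|, so |y| stays above δ = ε/B.
#0-factorʳ : ∀ {x y} → x * y # 0ℝ → y # 0ℝ
#0-factorʳ {x} {y} (ε , 0<ε , M , h) =
  let B , 0<B , K , hB = bounded x
      δ , 0<δ , Bδ≡ε   = solve-* 0<B 0<ε
  in δ , 0<δ , M ℕ.⊔ K , λ n n≥ →
    let a = seq x n ; b = seq y n in *-cancelˡ-≤-pos B {{positive 0<B}} (begin
    B ℚ.* δ
      ≡⟨ Bδ≡ε ⟩
    ε
      ≤⟨ h n (ℕₚ.m⊔n≤o⇒m≤o M K n≥) ⟩
    ∣ a ℚ.* b ℚ.- 0ℚ ∣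
      ≡⟨ trans (∣p-0∣≡∣p∣ (a ℚ.* b)) (∣p*q∣≡∣p∣*∣q∣ a b) ⟩
    ∣ a ∣ ℚ.* ∣ b ∣
      ≤⟨ *-monoʳ-≤-nonNeg ∣ b ∣ {{∣-∣-nonNeg b}} (hB n (ℕₚ.m⊔n≤o⇒n≤o M K n≥)) ⟩
    B ℚ.* ∣ b ∣
      ≡⟨ cong (B ℚ.*_) (sym (∣p-0∣≡∣p∣ b)) ⟩
    B ℚ.* ∣ b ℚ.- 0ℚ ∣ ∎)
  where open ≤-Reasoning

-- Turns termwise estimates by sums of squares into apartness; this is how both cofactors below are
-- shown to be invertible.
#0-mono : ∀ {x y} → (∀ n → 0ℚ ≤ seq x n) → (∀ n → 0ℚ ≤ seq y n ℚ.- seq x n) →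
          x # 0ℝ → y # 0ℝ
#0-mono {x} {y} 0≤x 0≤y-x (ε , 0<ε , N , h) = ε , 0<ε , N , λ n n≥ →
  let a = seq x n ; b = seq y n in begin
  ε             ≤⟨ h n n≥ ⟩
  ∣ a ℚ.- 0ℚ ∣  ≡⟨ trans (∣p-0∣≡∣p∣ a) (0≤p⇒∣p∣≡p (0≤x n)) ⟩
  a             ≤⟨ 0≤q-p⇒p≤q (0≤y-x n) ⟩
  b             ≤⟨ p≤∣p∣ b ⟩
  ∣ b ∣         ≡⟨ sym (∣p-0∣≡∣p∣ b) ⟩
  ∣ b ℚ.- 0ℚ ∣  ∎
  where open ≤-Reasoning

-- Reciprocals and cancellation.

-- The reciprocal, extended by the junk value recip 0 = 0.
recip : ℚ → ℚ
recip p with p ≟ 0ℚ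
... | yes _  = 0ℚ
... | no p≢0 = (1/ p) {{≢-nonZero p≢0}}

*-recip : ∀ {p} → p ≢ 0ℚ → p ℚ.* recip p ≡ 1ℚ
*-recip {p} p≢0 with p ≟ 0ℚ
... | yes p≡0 = contradiction p≡0 p≢0
... | no p≢0′ = *-inverseʳ p {{≢-nonZero p≢0′}}

bounded-below⇒≢0 : ∀ {p ε} → 0ℚ < ε → ε ≤ ∣ p ℚ.- 0ℚ ∣ → p ≢ 0ℚ
bounded-below⇒≢0 0<ε ε≤ refl = <-irrefl refl (<-≤-trans 0<ε ε≤)

reciprocal : ∀ x → x # 0ℝ → ∃[ y ] x * y ≃ 1ℝ
reciprocal x (ε , 0<ε , N , hx) = mkℝ (λ n → recip (seq x n)) cauchy-recip , inverse
  where
  open ≤-Reasoning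
  ≢0 : ∀ n → N ℕ.≤ n → seq x n ≢ 0ℚ
  ≢0 n n≥ = bounded-below⇒≢0 0<ε (hx n n≥)

  cauchy-recip : ∀ η → 0ℚ < η → ∃[ K ] ∀ m n → K ℕ.≤ m → K ℕ.≤ n →
                 ∣ recip (seq x m) ℚ.- recip (seq x n) ∣ < η
  cauchy-recip η 0<η =
    let 0<ε² = 0<*0< 0<ε 0<ε
        -- Since |1/a - 1/b| = |b - a| / |ab| and |ab| ≥ ε² beyond `N`, a difference of terms below
        -- ε²η suffices.
        M , h = cauchy x (ε ℚ.* ε ℚ.* η) (0<*0< 0<ε² 0<η)
    in N ℕ.⊔ M , λ m n m≥ n≥ →
      let a = seq x m ; b = seq x n ; a⁻¹ = recip a ; b⁻¹ = recip b
          N≤m = ℕₚ.m⊔n≤o⇒m≤o N M m≥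
          N≤n = ℕₚ.m⊔n≤o⇒m≤o N M n≥
          ab≥ε² : ε ℚ.* ε ≤ ∣ a ℚ.* b ∣
          ab≥ε² = ≤-trans
            (*-mono-≤ (<⇒≤ 0<ε) (0≤∣p∣ b) (subst (ε ≤_) (∣p-0∣≡∣p∣ a) (hx m N≤m))
                      (subst (ε ≤_) (∣p-0∣≡∣p∣ b) (hx n N≤n)))
            (≤-reflexive (sym (∣p*q∣≡∣p∣*∣q∣ a b)))
      in *-cancelˡ-<-nonNeg (ε ℚ.* ε) {{nonNegative (<⇒≤ 0<ε²)}} (begin-strict
        ε ℚ.* ε ℚ.* ∣ a⁻¹ ℚ.- b⁻¹ ∣
          ≤⟨ *-monoʳ-≤-nonNeg ∣ a⁻¹ ℚ.- b⁻¹ ∣ {{∣-∣-nonNeg (a⁻¹ ℚ.- b⁻¹)}} ab≥ε² ⟩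
        ∣ a ℚ.* b ∣ ℚ.* ∣ a⁻¹ ℚ.- b⁻¹ ∣
          ≡⟨ sym (∣p*q∣≡∣p∣*∣q∣ (a ℚ.* b) (a⁻¹ ℚ.- b⁻¹)) ⟩
        ∣ a ℚ.* b ℚ.* (a⁻¹ ℚ.- b⁻¹) ∣
          ≡⟨ cong ∣_∣ (solve 4 (λ a b a⁻¹ b⁻¹ → a :* b :* (a⁻¹ :- b⁻¹)
               := b :* (a :* a⁻¹) :- a :* (b :* b⁻¹)) refl a b a⁻¹ b⁻¹) ⟩
        ∣ b ℚ.* (a ℚ.* a⁻¹) ℚ.- a ℚ.* (b ℚ.* b⁻¹) ∣
          ≡⟨ cong₂ (λ u v → ∣ b ℚ.* u ℚ.- a ℚ.* v ∣) (*-recip (≢0 m N≤m)) (*-recip (≢0 n N≤n)) ⟩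
        ∣ b ℚ.* 1ℚ ℚ.- a ℚ.* 1ℚ ∣
          ≡⟨ cong₂ (λ u v → ∣ u ℚ.- v ∣) (*-identityʳ b) (*-identityʳ a) ⟩
        ∣ b ℚ.- a ∣
          <⟨ h n m (ℕₚ.m⊔n≤o⇒n≤o N M n≥) (ℕₚ.m⊔n≤o⇒n≤o N M m≥) ⟩
        ε ℚ.* ε ℚ.* η ∎)

  inverse : ∀ η → 0ℚ < η → Eventually λ n → ∣ seq x n ℚ.* recip (seq x n) ℚ.- 1ℚ ∣ < η
  -- Beyond `N` the product is exactly 1, so the same `N` serves every η.
  inverse η 0<η = N , λ n n≥ →
    subst (λ u → ∣ u ℚ.- 1ℚ ∣ < η) (sym (*-recip (≢0 n n≥))) 0<η

x*y≃0⇒x≃0 : ∀ {x y} → y # 0ℝ → x * y ≃ 0ℝ → x ≃ 0ℝ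
x*y≃0⇒x≃0 {x} {y} y#0 xy≃0 =
  let y⁻¹ , yy⁻¹≃1 = reciprocal y y#0 in begin
  x              ≈⟨ ≗⇒≃ {x} {1ℝ * x} (λ n → sym (*-identityˡ (seq x n))) ⟩
  1ℝ * x         ≈⟨ *-congʳ {y * y⁻¹} {1ℝ} x yy⁻¹≃1 ⟨
  y * y⁻¹ * x    ≈⟨ ≗⇒≃ {y * y⁻¹ * x} {x * y * y⁻¹} (λ n → solve 3
                     (λ x y y⁻¹ → y :* y⁻¹ :* x := x :* y :* y⁻¹) refl (seq x n) (seq y n) (seq y⁻¹ n)) ⟩
  x * y * y⁻¹    ≈⟨ *-congʳ {x * y} {0ℝ} y⁻¹ xy≃0 ⟩
  0ℝ * y⁻¹       ≈⟨ ≗⇒≃ {0ℝ * y⁻¹} {0ℝ} (λ n → *-zeroˡ (seq y⁻¹ n)) ⟩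
  0ℝ             ∎
  where open ≈-Reasoning ≃-setoid

-- Uniqueness of real cube roots.

¾ : ℚ
¾ = + 3 / 4

-- ¾s² is what remains of the form t² + ts + s² or t² - ts + s² after completing the square in t; it
-- bounds the cofactors from below.
¾s²#0 : ∀ {s} → s # 0ℝ → fromℚ ¾ * s ² # 0ℝ
¾s²#0 {s} s#0 = #0-*-#0 {fromℚ ¾} {s ²} (¾ , positive⁻¹ ¾ , 0 , λ _ _ → ≤-refl)
  (#0-*-#0 {s} {s} s#0 s#0)

0≤¾s² : ∀ s → 0ℚ ≤ ¾ ℚ.* (s ℚ.* s)
0≤¾s² s = 0≤*0≤ (nonNegative⁻¹ ¾) (0≤sq s)

-- Factor x³ - y³ = (x - y)(x² + xy + y²). The quadratic factor is (x + y/2)² + ¾y², hence apart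
-- from zero, and can be cancelled.
³-injective : ∀ {x y} → y # 0ℝ → x ³ ≃ y ³ → x ≃ y
³-injective {x} {y} y#0 x³≃y³ = begin
  x             ≈⟨ ≗⇒≃ {x} {x - y + y} (λ n → solve 2 (λ x y → x := x :- y :+ y) refl (seq x n) (seq y n)) ⟩
  x - y + y     ≈⟨ +-cong {x - y} {0ℝ} {y} {y} x-y≃0 (≃-refl {y}) ⟩
  0ℝ + y        ≈⟨ ≗⇒≃ {0ℝ + y} {y} (λ n → +-identityˡ (seq y n)) ⟩
  y             ∎
  where
  open ≈-Reasoning ≃-setoid
  cofactor : ℝ
  cofactor = x ² + x * y + y ²

  cofactor#0 : cofactor # 0ℝ
  cofactor#0 = #0-mono {fromℚ ¾ * y ²} {cofactor} (λ n → 0≤¾s² (seq y n))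
    (λ n → subst (0ℚ ≤_)
      (solve 2 (λ x y → (x :+ con ½ :* y) :* (x :+ con ½ :* y)
                 := x :* x :+ x :* y :+ y :* y :- con ¾ :* (y :* y)) refl (seq x n) (seq y n))
      (0≤sq (seq x n ℚ.+ ½ ℚ.* seq y n)))
    (¾s²#0 {y} y#0)

  x-y≃0 : x - y ≃ 0ℝ
  x-y≃0 = x*y≃0⇒x≃0 {x - y} {cofactor} cofactor#0 (begin
    (x - y) * cofactor  ≈⟨ ≗⇒≃ {(x - y) * cofactor} {x ³ - y ³} (λ n → solve 2
                            (λ x y → (x :- y) :* (x :* x :+ x :* y :+ y :* y)
                              := x :* x :* x :- y :* y :* y) refl (seq x n) (seq y n)) ⟩
    x ³ - y ³           ≈⟨ +-cong {x ³} {y ³} { - (y ³)} { - (y ³)} x³≃y³ (≃-refl { - (y ³)}) ⟩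
    y ³ - y ³           ≈⟨ ≗⇒≃ {y ³ - y ³} {0ℝ} (λ n → +-inverseʳ (seq (y ³) n)) ⟩
    0ℝ                  ∎)

-- Zeros of ρ

+ᶜ-cong : ∀ {z z′ w w′} → z ≃ᶜ z′ → w ≃ᶜ w′ → z +ᶜ w ≃ᶜ z′ +ᶜ w′
+ᶜ-cong {z} {z′} {w} {w′} (re≃ , im≃) (re≃′ , im≃′) =
  +-cong {re z} {re z′} {re w} {re w′} re≃ re≃′ , +-cong {im z} {im z′} {im w} {im w′} im≃ im≃′

*ᶜ-congʳ : ∀ {z z′} w → z ≃ᶜ z′ → z *ᶜ w ≃ᶜ z′ *ᶜ w
*ᶜ-congʳ {z} {z′} w (re≃ , im≃) =
  +-cong {re z * re w} {re z′ * re w} { - (im z * im w)} { - (im z′ * im w)}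
    (*-congʳ {re z} {re z′} (re w) re≃)
    (neg-cong {im z * im w} {im z′ * im w} (*-congʳ {im z} {im z′} (im w) im≃)) ,
  +-cong {re z * im w} {re z′ * im w} {im z * re w} {im z′ * re w}
    (*-congʳ {re z} {re z′} (im w) re≃) (*-congʳ {im z} {im z′} (re w) im≃)

fromℝ-cong : ∀ {x y} → x ≃ y → fromℝ x ≃ᶜ fromℝ y
fromℝ-cong x≃y = x≃y , ≃-refl {0ℝ}

-- A polynomial of the form ρ agrees with `ρ h s` only up to `≃` of coefficients; this moves its
-- zeros to `ρ h s`.
eval-cong : ∀ {f g} z → f ≈ g → eval f z ≃ᶜ eval g z
eval-cong {x³+ p x²+ q x+ r} {x³+ p′ x²+ q′ x+ r′} z (p≃ , q≃ , r≃) =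
  +ᶜ-cong {z³ +ᶜ P *ᶜ z² +ᶜ Q *ᶜ z} {z³ +ᶜ P′ *ᶜ z² +ᶜ Q′ *ᶜ z} {fromℝ r} {fromℝ r′}
    (+ᶜ-cong {z³ +ᶜ P *ᶜ z²} {z³ +ᶜ P′ *ᶜ z²} {Q *ᶜ z} {Q′ *ᶜ z}
      (+ᶜ-cong {z³} {z³} {P *ᶜ z²} {P′ *ᶜ z²}
        (≃-refl {re z³} , ≃-refl {im z³})
        (*ᶜ-congʳ {P} {P′} z² (fromℝ-cong {p} {p′} p≃)))
      (*ᶜ-congʳ {Q} {Q′} z (fromℝ-cong {q} {q′} q≃)))
    (fromℝ-cong {r} {r′} r≃)
  where
  z² = z *ᶜ z
  z³ = z² *ᶜ z
  P  = fromℝ p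
  P′ = fromℝ p′
  Q  = fromℝ q
  Q′ = fromℝ q′

ρ-zeros-real : ∀ h s → s # 0ℝ → ∀ z → IsZero (ρ h s) z → IsReal z
ρ-zeros-real h s s#0 z (Re≃0 , Im≃0) = x*y≃0⇒x≃0 {b} {cofactor} cofactor#0 (begin
  b * cofactor       ≈⟨ ≗⇒≃ {b * cofactor} {Im * m₁ - Re * m₂} (λ n →
                          identity (seq h n) (seq s n) (seq a n) (seq b n)) ⟩
  Im * m₁ - Re * m₂  ≈⟨ +-cong {Im * m₁} {0ℝ * m₁} { - (Re * m₂)} { - (0ℝ * m₂)}
                          (*-congʳ {Im} {0ℝ} m₁ Im≃0)
                          (neg-cong {Re * m₂} {0ℝ * m₂} (*-congʳ {Re} {0ℝ} m₂ Re≃0)) ⟩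
  0ℝ * m₁ - 0ℝ * m₂  ≈⟨ ≗⇒≃ {0ℝ * m₁ - 0ℝ * m₂} {0ℝ} (λ n →
                          cong₂ ℚ._-_ (*-zeroˡ (seq m₁ n)) (*-zeroˡ (seq m₂ n))) ⟩
  0ℝ                 ∎)
  where
  open ≈-Reasoning ≃-setoid
  a b Re Im m₁ m₂ cofactor : ℝ
  a  = re z
  b  = im z
  Re = re (eval (ρ h s) z)
  Im = im (eval (ρ h s) z)
  -- m₁ + m₂ i = M(z)
  m₁ = a * a - b * b - s * a
  m₂ = a * b + b * a - s * b
  cofactor = (a * a + b * b + s * s - s * a) ² + (s * b) ²

  -- The right side is the imaginary part of ρ(h,s,z) times M̄(z). There `h` enters only through the
  -- real number hs|M(z)|², so it drops out on the left.
  identity : ∀ h s a b →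
    b ℚ.* ((a ℚ.* a ℚ.+ b ℚ.* b ℚ.+ s ℚ.* s ℚ.- s ℚ.* a) ℚ.* (a ℚ.* a ℚ.+ b ℚ.* b ℚ.+ s ℚ.* s ℚ.- s ℚ.* a)
           ℚ.+ (s ℚ.* b) ℚ.* (s ℚ.* b))
    ≡ _
  identity = solve 4 (λ h s a b →
    -- These terms copy the unfolding of `eval` symbol by symbol, with `o` for the zero imaginary
    -- parts of the coefficients, so that `R` and `I` match the terms of `Re` and `Im`
    -- definitionally.
    let u₂ = a :* a :- b :* b
        v₂ = a :* b :+ b :* a
        u₃ = u₂ :* a :- v₂ :* b
        v₃ = u₂ :* b :+ v₂ :* a
        p  = h :* s
        q  = :- ((h :+ con (+ 3 / 1)) :* (s :* s))
        r  = s :* s :* s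
        o  = con 0ℚ
        R  = u₃ :+ (p :* u₂ :- o :* v₂) :+ (q :* a :- o :* b) :+ r
        I  = v₃ :+ (p :* v₂ :+ o :* u₂) :+ (q :* b :+ o :* a) :+ o
        w  = a :* a :+ b :* b :+ s :* s :- s :* a
    in b :* (w :* w :+ (s :* b) :* (s :* b))
         := I :* (u₂ :- s :* a) :- R :* (v₂ :- s :* b)) refl

  cofactor#0 : cofactor # 0ℝ
  cofactor#0 = #0-mono {¾s² * ¾s²} {cofactor} (λ n → 0≤sq (seq ¾s² n))
    (λ n → let s = seq s n ; a = seq a n ; b = seq b n
               a-½s = a ℚ.- ½ ℚ.* s
      in subst (0ℚ ≤_)
      (solve 3 (λ s a b →
        -- Completing the square gives e = w + d, so e² - d² = (e - d)(e + d) = w(w + 2d), a product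
        -- of nonnegative factors.
        let a-½s = a :- con ½ :* s
            w = a-½s :* a-½s :+ b :* b
            d = con ¾ :* (s :* s)
            e = a :* a :+ b :* b :+ s :* s :- s :* a
        in w :* (w :+ (d :+ d)) :+ (s :* b) :* (s :* b)
             := e :* e :+ (s :* b) :* (s :* b) :- d :* d) refl s a b)
      (+-mono-≤
        (0≤*0≤ (0≤w a-½s b) (+-mono-≤ (0≤w a-½s b) (+-mono-≤ (0≤¾s² s) (0≤¾s² s))))
        (0≤sq (s ℚ.* b))))
    (#0-*-#0 {¾s²} {¾s²} (¾s²#0 {s} s#0) (¾s²#0 {s} s#0))
    where
    ¾s² = fromℚ ¾ * s ²
    0≤w : ∀ c d → 0ℚ ≤ c ℚ.* c ℚ.+ d ℚ.* d
    0≤w c d = +-mono-≤ (0≤sq c) (0≤sq d)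

-- The two directions of the equivalence.

RCP⇒ρ : ∀ p q r → IsRCP (x³+ p x²+ q x+ r) →
        ∃[ h ] ∃[ s ] (s # 0ℝ × (x³+ p x²+ q x+ r) ≈ ρ h s)
RCP⇒ρ p q r rcp = h , s , s#0 , ≃-sym {h * s} {p} hs≃p , q≃ , ≃-sym {s ³} {r} (cbrt-³ r)
  where
  open IsRCP rcp
  open ≈-Reasoning ≃-setoid
  s : ℝ
  s = cbrt r

  s#0 : s # 0ℝ
  -- The product s² · s is s³ ≃ r, which is apart from zero; so its last factor is too.
  s#0 = #0-factorʳ {s ²} {s} (#0-resp-≃ {r} {s ³} (≃-sym {s ³} {r} (cbrt-³ r)) r#0)

  s⁻¹ h : ℝ
  s⁻¹ = proj₁ (reciprocal s s#0)
  h   = p * s⁻¹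

  hs≃p : h * s ≃ p
  hs≃p = let _ , ss⁻¹≃1 = reciprocal s s#0 in begin
    p * s⁻¹ * s    ≈⟨ ≗⇒≃ {p * s⁻¹ * s} {s * s⁻¹ * p} (λ n → solve 3
                       (λ p s s⁻¹ → p :* s⁻¹ :* s := s :* s⁻¹ :* p) refl (seq p n) (seq s n) (seq s⁻¹ n)) ⟩
    s * s⁻¹ * p    ≈⟨ *-congʳ {s * s⁻¹} {1ℝ} p ss⁻¹≃1 ⟩
    1ℝ * p         ≈⟨ ≗⇒≃ {1ℝ * p} {p} (λ n → *-identityˡ (seq p n)) ⟩
    p              ∎

  q≃ : q ≃ - ((h + 3ℝ) * s ²)
  q≃ = begin
    q
      -- Adding and subtracting ps + 3s² exposes the left side of `relation`, which vanishes; p ≃ hs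
      -- then turns the remainder into the required coefficient.
      ≈⟨ ≗⇒≃ {q} {p * s + 3ℝ * s ² + q - (p * s + 3ℝ * s ²)} (λ n → solve 3
           (λ p q s → let t = p :* s :+ con (+ 3 / 1) :* (s :* s) in q := t :+ q :- t)
           refl (seq p n) (seq q n) (seq s n)) ⟩
    p * s + 3ℝ * s ² + q - (p * s + 3ℝ * s ²)
      ≈⟨ +-cong {p * s + 3ℝ * s ² + q} {0ℝ} { - (p * s + 3ℝ * s ²)} { - (h * s * s + 3ℝ * s ²)} relation
           (neg-cong {p * s + 3ℝ * s ²} {h * s * s + 3ℝ * s ²}
             (+-cong {p * s} {h * s * s} {3ℝ * s ²} {3ℝ * s ²}
               (*-congʳ {p} {h * s} s (≃-sym {h * s} {p} hs≃p)) (≃-refl {3ℝ * s ²}))) ⟩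
    0ℝ - (h * s * s + 3ℝ * s ²)
      ≈⟨ ≗⇒≃ {0ℝ - (h * s * s + 3ℝ * s ²)} { - ((h + 3ℝ) * s ²)} (λ n → solve 2
           (λ h s → con 0ℚ :- (h :* s :* s :+ con (+ 3 / 1) :* (s :* s))
              := :- ((h :+ con (+ 3 / 1)) :* (s :* s))) refl (seq h n) (seq s n)) ⟩
    - ((h + 3ℝ) * s ²) ∎

ρ⇒RCP : ∀ p q r → ∃[ h ] ∃[ s ] (s # 0ℝ × (x³+ p x²+ q x+ r) ≈ ρ h s) →
        IsRCP (x³+ p x²+ q x+ r)
ρ⇒RCP p q r (h , s , s#0 , f≈ρ@(p≃ , q≃ , r≃)) = record
  { r#0        = #0-resp-≃ {s ³} {r} (≃-sym {r} {s ³} r≃)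
                   (#0-*-#0 {s ²} {s} (#0-*-#0 {s} {s} s#0 s#0) s#0)
  ; zeros-real = λ z (Re≃0 , Im≃0) →
      let Re≃ , Im≃ = eval-cong {f} {ρ h s} z f≈ρ in
      ρ-zeros-real h s s#0 z
        ( ≃-trans {re (eval (ρ h s) z)} {re (eval f z)} {0ℝ}
            (≃-sym {re (eval f z)} {re (eval (ρ h s) z)} Re≃) Re≃0
        , ≃-trans {im (eval (ρ h s) z)} {im (eval f z)} {0ℝ}
            (≃-sym {im (eval f z)} {im (eval (ρ h s) z)} Im≃) Im≃0)
  ; relation   = begin
      -- With `s` in place of the cube root `c` and the coefficients of ρ for `p` and `q`, the
      -- relation is an identity in `h` and `s`.
      p * c + 3ℝ * c ² + q
        ≈⟨ +-cong {p * c + 3ℝ * c ²} {h * s * s + 3ℝ * s ²} {q} { - ((h + 3ℝ) * s ²)}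
             (+-cong {p * c} {h * s * s} {3ℝ * c ²} {3ℝ * s ²}
               (*-cong {p} {h * s} {c} {s} p≃ c≃s)
               (*-cong {3ℝ} {3ℝ} {c ²} {s ²} (≃-refl {3ℝ}) (*-cong {c} {s} {c} {s} c≃s c≃s))) q≃ ⟩
      h * s * s + 3ℝ * s ² - (h + 3ℝ) * s ²
        ≈⟨ ≗⇒≃ {h * s * s + 3ℝ * s ² - (h + 3ℝ) * s ²} {0ℝ} (λ n → solve 2
             (λ h s → h :* s :* s :+ con (+ 3 / 1) :* (s :* s)
                :- (h :+ con (+ 3 / 1)) :* (s :* s) := con 0ℚ) refl (seq h n) (seq s n)) ⟩
      0ℝ ∎
  }
  where
  open ≈-Reasoning ≃-setoid
  f : MonicCubic
  f = x³+ p x²+ q x+ r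

  c : ℝ
  c = cbrt r

  c≃s : c ≃ s
  -- Both cubes equal `r`: c³ by construction of `cbrt`, s³ as the constant coefficient of ρ.
  c≃s = ³-injective {c} {s} s#0 (≃-trans {c ³} {r} {s ³} (cbrt-³ r) r≃)

corollary4 : (p q r : ℝ) →
    IsRCP (x³+ p x²+ q x+ r) ⇔
    (∃[ h ] ∃[ s ] (s # 0ℝ × (x³+ p x²+ q x+ r) ≈ ρ h s))
corollary4 p q r = mk⇔ (RCP⇒ρ p q r) (ρ⇒RCP p q r)
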